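{- Let $C$ be a constant and suppose that $f(k,k)\le 2k+C$ for all positive integers $k$. Then for every positive integer $k$, every $k$-ECSM instance $(G,c)$ has a feasible solution of cost at most $(1+C/k)\cdot\mathrm{OPT}(\mathcal{N}_k)$, where $\mathrm{OPT}(\mathcal{N}_k)$ is the optimal value of the linear program $(\mathcal{N}_k)$ for that instance; i.e. the integrality gap of $(\mathcal{N}_k)$ is at most $1+C/k$.
   Context: For positive integers $A,B$, $f(A,B)$ is the least integer $f$ such that the edge set of every $f$-edge-connected multigraph can be partitioned into two parts so that the spanning subgraph formed by one part is $A$-edge-connected and the spanning subgraph formed by the other part is $B$-edge-connected. (A multigraph is $m$-edge-connected if every cut $\delta(S)$, $\varnothing\ne S\subsetneq V$, contains at least $m$ edges counted with multiplicity; $f(A,B)$ is finite.) A $k$-ECSM instance consists of a finite connected undirected graph $G=(V,E)$ and nonnegative edge costs $c_e$. A feasible solution is a multi-subset $F$ of $E$ (each edge may be taken any number of times, each copy costing $c_e$) such that the multigraph $(V,F)$ is $k$-edge-connected; its cost is the sum of costs with multiplicity. The LP relaxation is $$(\mathcal{N}_k)\qquad \min\Big\{\sum_{e\in E}c_ex_e:\ x\in\mathbb{R}^E,\ \sum_{e\in\delta(S)}x_e\ge k\ \ \forall\,\varnothing\ne S\subsetneq V,\ x_e\ge0\ \ \forall e\in E\Big\},$$ where $\delta(S)$ is the set of edges with exactly one end in $S$. The integrality gap is the worst-case ratio, over instances, of the optimal integral (i.e. $k$-ECSM) cost to the LP optimum. -}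

module Defs where

open import Algebra.Bundles using (CommutativeRing)
import Algebra.Definitions.RawMonoid as RawMonoidDefinitions
open import Data.Fin.Base using (Fin)
open import Data.Fin.Subset using (Subset; _∈_; _∉_; _⊂_; Nonempty; ⊤)
open import Data.Fin.Subset.Properties using (_∈?_)
open import Data.List.Base using (List; _++_; allFin; filter; foldr; length; lookup; map)
open import Data.List.Relation.Binary.Permutation.Propositional using (_↭_)
open import Data.Nat.Base as ℕ using (ℕ)
open import Data.Product.Base using (∃-syntax; _×_; _,_; proj₁; proj₂)
open import Data.Sum.Base using (_⊎_)
open import Function.Base using (_∘_)
open import Level using (_⊔_; suc)
open import Relation.Binary.Construct.Closure.ReflexiveTransitive using (Star)
open import Relation.Binary.Core using (Rel)
open import Relation.Binary.PropositionalEquality.Core using (_≡_)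
open import Relation.Binary.Structures using (IsDecTotalOrder)
open import Relation.Nullary.Decidable using (Dec; _×-dec_; _⊎-dec_; ¬?)
open import Relation.Nullary.Negation using (¬_)
open import Relation.Unary using (Pred)

IsMinimum : ∀ {a p r} {A : Set a} → Rel A r → Pred A p → A → Set (a ⊔ p ⊔ r)
IsMinimum _≤_ P m = P m × (∀ n → P n → m ≤ n)

-- The scalars. The library has no real numbers; the classical ordered field ℝ
-- (whose order is decidable classically) is a model, and so is ℚ.

record ArchimedeanOrderedField c ℓ₁ ℓ₂ : Set (suc (c ⊔ ℓ₁ ⊔ ℓ₂)) where
  field
    commutativeRing : CommutativeRing c ℓ₁

  open CommutativeRing commutativeRing public

  infix 4 _≤_
  infix 9 _⁻¹

  -- n ×1 is the image of the natural number n.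
  _×1 : ℕ → Carrier
  n ×1 = RawMonoidDefinitions._×_ +-rawMonoid n 1#

  field
    _≤_             : Rel Carrier ℓ₂
    isDecTotalOrder : IsDecTotalOrder _≈_ _≤_
    +-monoˡ-≤       : ∀ x {y z} → y ≤ z → y + x ≤ z + x
    *-nonneg        : ∀ {x y} → 0# ≤ x → 0# ≤ y → 0# ≤ x * y
    0≉1             : ¬ (0# ≈ 1#)
    -- As usual for a total inverse, the value at 0# is unconstrained.
    _⁻¹             : Carrier → Carrier
    *-inverseʳ      : ∀ {x} → ¬ (x ≈ 0#) → x * x ⁻¹ ≈ 1#
    archimedean     : ∀ x → ∃[ n ] x ≤ n ×1

  ∑ : ∀ {a} {A : Set a} → List A → (A → Carrier) → Carrier
  ∑ es g = foldr _+_ 0# (map g es)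

-- Edges have their own identities, so parallel edges are possible; loops are
-- also allowed, and lie in no cut.

record Multigraph : Set where
  field
    #V #E : ℕ
    ends  : Fin #E → Fin #V × Fin #V

module _ (G : Multigraph) where
  open Multigraph G

  Adjacent : Rel (Fin #V) _
  Adjacent u v = ∃[ e ] (ends e ≡ (u , v) ⊎ ends e ≡ (v , u))

  Connected : Set
  Connected = ∀ u v → Star Adjacent u v

  Crosses : Subset #V → Fin #E → Set
  Crosses S e = (u ∈ S × v ∉ S) ⊎ (u ∉ S × v ∈ S)
    where
    u = proj₁ (ends e)
    v = proj₂ (ends e)

  crosses? : ∀ S e → Dec (Crosses S e)
  crosses? S e =
    ((u ∈? S) ×-dec ¬? (v ∈? S)) ⊎-dec (¬? (u ∈? S) ×-dec (v ∈? S))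
    where
    u = proj₁ (ends e)
    v = proj₂ (ends e)

  δ : Subset #V → List (Fin #E)
  δ S = filter (crosses? S) (allFin #E)

  EdgeConnected : ℕ → Set
  EdgeConnected m = ∀ S → Nonempty S → S ⊂ ⊤ → m ℕ.≤ length (δ S)

-- A list of edges stands for a multi-subset F of E; G ⟨ F ⟩ is the multigraph
-- (V , F), with one edge for each entry of the list.

infix 9 _⟨_⟩

_⟨_⟩ : (G : Multigraph) → List (Fin (Multigraph.#E G)) → Multigraph
G ⟨ F ⟩ = record
  { #V   = Multigraph.#V G
  ; #E   = length F
  ; ends = Multigraph.ends G ∘ lookup F
  }

-- P ++ Q is a rearrangement of the list of all edges, each of which occurs in
-- it exactly once: P and Q partition the edge set.

Splits : ℕ → ℕ → Multigraph → Set
Splits A B G =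
  ∃[ P ] ∃[ Q ] (P ++ Q ↭ allFin (Multigraph.#E G)
                 × EdgeConnected (G ⟨ P ⟩) A
                 × EdgeConnected (G ⟨ Q ⟩) B)

-- f[ A , B ]≡ n says that f(A,B) = n.

f[_,_]≡_ : ℕ → ℕ → ℕ → Set
f[ A , B ]≡ n =
  IsMinimum ℕ._≤_ (λ m → ∀ G → EdgeConnected G m → Splits A B G) n

module _ {c ℓ₁ ℓ₂} (K : ArchimedeanOrderedField c ℓ₁ ℓ₂) where
  open ArchimedeanOrderedField K

  record Instance : Set (c ⊔ ℓ₂) where
    field
      graph     : Multigraph
      connected : Connected graph
    open Multigraph graph public
    field
      cost   : Fin #E → Carrier
      cost≥0 : ∀ e → 0# ≤ cost e

    totalCost : List (Fin #E) → Carrier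
    totalCost F = ∑ F cost

    lpCost : (Fin #E → Carrier) → Carrier
    lpCost x = ∑ (allFin #E) (λ e → cost e * x e)

  module _ (k : ℕ) (I : Instance) where
    open Instance I

    Feasible : List (Fin #E) → Set
    Feasible F = EdgeConnected (graph ⟨ F ⟩) k

    record LPFeasible (x : Fin #E → Carrier) : Set ℓ₂ where
      field
        cut≥k : ∀ S → Nonempty S → S ⊂ ⊤ → k ×1 ≤ ∑ (δ graph S) x
        x≥0   : ∀ e → 0# ≤ x e

    IsOptimum : Carrier → Set (c ⊔ ℓ₁ ⊔ ℓ₂)
    IsOptimum = IsMinimum _≤_ (λ v → ∃[ F ] (Feasible F × totalCost F ≈ v))

    IsLPOptimum : Carrier → Set (c ⊔ ℓ₁ ⊔ ℓ₂)
    IsLPOptimum = IsMinimum _≤_ (λ v → ∃[ x ] (LPFeasible x × lpCost x ≈ v))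

  -- The supremum of the ratios opt / lp is at most ρ; multiplied out, so that
  -- lp = 0 forces opt = 0.

  IntegralityGapAtMost : ℕ → Carrier → Set (c ⊔ ℓ₁ ⊔ ℓ₂)
  IntegralityGapAtMost k ρ =
    ∀ I opt lp → IsOptimum k I opt → IsLPOptimum k I lp → opt ≤ ρ * lp

{-# OPTIONS --safe #-}

-- Iterating f(k,k) ≤ 2k + C, that is f(k,k) + C ≤ 2 (k + C), and keeping the
-- cheaper part of each split, turns a g-edge-connected multi-subset F into a
-- k-edge-connected one of cost at most cost(F) / 2ʲ, where g + C ≤ 2ʲ (k + C).
-- Rounding up (g / k) x for an optimal LP solution x gives such an F of cost at
-- most (g / k) opt + ∑ c, so there are feasible solutions of cost at most
-- (1 + C / k) opt + D / 2ʲ with D independent of j. No multiplicity above k is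
-- ever needed, so these solutions may be drawn from a finite set, and the error
-- term disappears once j is large.

module Submission where

open import Defs
open import Data.Nat.Base as ℕ using (ℕ; NonZero)
open import Data.Product.Base using (∃-syntax; _×_)

import Algebra.Properties.Ring as RingProperties
import Algebra.Properties.Semiring.Mult as SemiringMult
import Algebra.Solver.Ring.NaturalCoefficients.Default as SemiringSolver
open import Data.Bool.Base using (true; false)
open import Data.Empty using (⊥-elim)
open import Data.Fin.Base as Fin using (Fin)
import Data.Fin.Properties as Fin
open import Data.Fin.Subset using (inside; outside)
open import Data.Fin.Subset.Properties using (⊆⊤; ∈⊤)
open import Data.List.Base
  using (List; []; _∷_; _++_; allFin; cartesianProductWith; concatMap; filter; foldr;
    length; lookup; map; replicate)
open import Data.List.Membership.Propositional using (_∈_)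
open import Data.List.Membership.Propositional.Properties
  using (∈-allFin; ∈-cartesianProductWith⁺)
open import Data.List.Properties
  using (filter-++; filter-all; filter-none; length-map; map-++; map-tabulate; tabulate-lookup)
open import Data.List.Relation.Binary.Permutation.Propositional as ↭ using (_↭_)
import Data.List.Relation.Binary.Permutation.Propositional.Properties as ↭
open import Data.List.Relation.Binary.Sublist.Propositional as Sublist using (_⊆_; ⊆-refl)
import Data.List.Relation.Binary.Sublist.Propositional.Properties as Sublist
open import Data.List.Relation.Unary.All as All using (All; []; _∷_)
import Data.List.Relation.Unary.All.Properties as All
open import Data.List.Relation.Unary.Any using (here; there)
import Data.Nat.Properties as ℕ
open import Data.Product.Base using (_,_; proj₁; proj₂)
open import Data.Sum.Base as Sum using (_⊎_; inj₁; inj₂)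
import Data.Vec.Base as Vec
open import Function.Base using (_∘_; const)
open import Relation.Binary.Bundles using (Poset)
open import Relation.Binary.Definitions using (DecidableEquality)
open import Relation.Binary.PropositionalEquality as ≡ using (_≡_; cong; subst)
import Relation.Binary.Reasoning.PartialOrder as PosetReasoning
open import Relation.Binary.Structures using (IsDecTotalOrder)
open import Relation.Nullary.Decidable using (yes; no; does; _because_; ¬?)
open import Relation.Nullary.Negation using (¬_)
open import Relation.Unary using (Decidable)

-- Lists as multisets: filtering, multiplicities, lists of bounded length

module _ {a b p} {A : Set a} {B : Set b} {P : B → Set p} (P? : Decidable P) where

  filter-map : (f : A → B) (xs : List A) →
    filter P? (map f xs) ≡ map f (filter (P? ∘ f) xs)
  filter-map f [] = ≡.refl
  filter-map f (x ∷ xs) with does (P? (f x))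
  ... | true  = cong (f x ∷_) (filter-map f xs)
  ... | false = filter-map f xs

  length-filter-map : (f : A → B) (xs : List A) →
    length (filter P? (map f xs)) ≡ length (filter (P? ∘ f) xs)
  length-filter-map f xs = ≡.trans (cong length (filter-map f xs)) (length-map f (filter (P? ∘ f) xs))

map-lookup-allFin : ∀ {a} {A : Set a} (xs : List A) → map (lookup xs) (allFin (length xs)) ≡ xs
map-lookup-allFin xs = ≡.trans (map-tabulate (λ i → i) (lookup xs)) (tabulate-lookup xs)

module _ {a} {A : Set a} where

  withMultiplicity : (A → ℕ) → List A → List A
  withMultiplicity m = concatMap (λ e → replicate (m e) e)

  -- All copies of `e` pass or fail the test together. For `P?` the crossing test, this expresses a
  -- cut of the rounded multi-subset through the cut of the original graph.
  filter-withMultiplicity : ∀ {p} {P : A → Set p} (P? : Decidable P) m es →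
    filter P? (withMultiplicity m es) ≡ withMultiplicity m (filter P? es)
  filter-withMultiplicity P? m [] = ≡.refl
  filter-withMultiplicity P? m (e ∷ es) = ≡.trans
    (filter-++ P? (replicate (m e) e) (withMultiplicity m es))
    (≡.trans (cong (filter P? (replicate (m e) e) ++_) (filter-withMultiplicity P? m es)) head)
    where
    head : filter P? (replicate (m e) e) ++ withMultiplicity m (filter P? es)
           ≡ withMultiplicity m (filter P? (e ∷ es))
    head with P? e
    ... | yes pe = cong (_++ _) (filter-all P? (All.replicate⁺ (m e) pe))
    ... | no ¬pe = cong (_++ _) (filter-none P? (All.replicate⁺ (m e) ¬pe))

  length-filter+filter-¬ : ∀ {p} {P : A → Set p} (P? : Decidable P) xs →
    length xs ≡ length (filter P? xs) ℕ.+ length (filter (¬? ∘ P?) xs)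
  length-filter+filter-¬ P? [] = ≡.refl
  length-filter+filter-¬ P? (x ∷ xs) with ih ← length-filter+filter-¬ P? xs | P? x
  ... | true because _ = cong ℕ.suc ih
  ... | false because _ = ≡.trans (cong ℕ.suc ih) (≡.sym (ℕ.+-suc _ _))

  listsUpTo : ℕ → List A → List (List A)
  listsUpTo ℕ.zero    es = [] ∷ []
  listsUpTo (ℕ.suc n) es = [] ∷ cartesianProductWith _∷_ es (listsUpTo n es)

  ∈-listsUpTo : ∀ {es} n xs → All (_∈ es) xs → length xs ℕ.≤ n → xs ∈ listsUpTo n es
  ∈-listsUpTo ℕ.zero    []       _        _             = here ≡.refl
  ∈-listsUpTo (ℕ.suc n) []       _        _             = here ≡.refl
  ∈-listsUpTo (ℕ.suc n) (x ∷ xs) (i ∷ is) (ℕ.s≤s short) =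
    there (∈-cartesianProductWith⁺ _∷_ i (∈-listsUpTo n xs is short))

-- Capping multiplicities at k

module _ {a} {A : Set a} (_≟_ : DecidableEquality A) where

  count : A → List A → ℕ
  count e = length ∘ filter (e ≟_)

  count-mono : ∀ e {xs ys} → xs ⊆ ys → count e xs ℕ.≤ count e ys
  count-mono e xs⊆ys =
    Sublist.length-mono-≤ (Sublist.filter⁺ (e ≟_) (e ≟_) (λ { ≡.refl p → p }) xs⊆ys)

  count≤length-filter : ∀ {p} {P : A → Set p} (P? : Decidable P) {e} → P e →
    ∀ xs → count e xs ℕ.≤ length (filter P? xs)
  count≤length-filter P? {e} pe xs =
    Sublist.length-mono-≤ (Sublist.filter⁺ (e ≟_) P? (λ { ≡.refl ≡.refl → pe }) (⊆-refl {x = xs}))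

  -- Induction on `es`: removing all copies of the head `e` costs at most `k` entries, and what
  -- remains lies in the tail of `es`, still with multiplicities at most `k`.
  length≤length*count : ∀ k es xs → All (_∈ es) xs → (∀ e → count e xs ℕ.≤ k) →
    length xs ℕ.≤ length es ℕ.* k
  length≤length*count k []       []      _        _ = ℕ.z≤n
  length≤length*count k []       (_ ∷ _) (() ∷ _) _
  length≤length*count k (e ∷ es) xs      is bounded = begin
    length xs                        ≡⟨ length-filter+filter-¬ (e ≟_) xs ⟩
    count e xs ℕ.+ length others     ≤⟨ ℕ.+-mono-≤ (bounded e) others≤ ⟩
    k ℕ.+ length es ℕ.* k            ∎
    where
    open ℕ.≤-Reasoning
    others : List A
    others = filter (¬? ∘ (e ≟_)) xs
    others∈ : All (_∈ es) others
    others∈ = All.zipWith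
      (λ { (here ≡.refl , e≢e) → ⊥-elim (e≢e ≡.refl) ; (there i , _) → i })
      (All.filter⁺ (¬? ∘ (e ≟_)) is , All.all-filter (¬? ∘ (e ≟_)) xs)
    others≤ : length others ℕ.≤ length es ℕ.* k
    others≤ = length≤length*count k es others others∈
      (λ e′ → ℕ.≤-trans (count-mono e′ (Sublist.filter-⊆ (¬? ∘ (e ≟_)) xs)) (bounded e′))

  insertUpTo : ℕ → A → List A → List A
  insertUpTo k e xs with k ℕ.≤? count e xs
  ... | yes _ = xs
  ... | no  _ = e ∷ xs

  -- Each multiplicity is replaced by its minimum with `k`. Entries are only dropped, never
  -- reordered, so the result is a sublist and costs no more when costs are nonnegative.
  truncate : ℕ → List A → List A
  truncate k = foldr (insertUpTo k) []

  count-truncate : ∀ k e xs → count e (truncate k xs) ℕ.≤ k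
  count-truncate k e [] = ℕ.z≤n
  count-truncate k e (x ∷ xs) with k ℕ.≤? count x (truncate k xs)
  ... | yes _ = count-truncate k e xs
  ... | no k≰ with e ≟ x
  ...   | yes ≡.refl = ℕ.≰⇒> k≰
  ...   | no _       = count-truncate k e xs

  truncate-⊆ : ∀ k xs → truncate k xs ⊆ xs
  truncate-⊆ k [] = Sublist.[]
  truncate-⊆ k (x ∷ xs) with k ℕ.≤? count x (truncate k xs)
  ... | yes _ = x Sublist.∷ʳ truncate-⊆ k xs
  ... | no  _ = ≡.refl Sublist.∷ truncate-⊆ k xs

  -- A copy of `x` is dropped only when `k` copies of `x` are already kept. If `x` satisfies `P`,
  -- those `k` copies alone give the second alternative; if not, the drop is invisible to the
  -- filter. With `P` the crossing test, capping at `k` therefore cannot destroy a cut of size at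
  -- least `k`.
  length-filter-truncate : ∀ {p} {P : A → Set p} (P? : Decidable P) k xs →
    length (filter P? xs) ℕ.≤ length (filter P? (truncate k xs))
    ⊎ k ℕ.≤ length (filter P? (truncate k xs))
  length-filter-truncate P? k [] = inj₁ ℕ.z≤n
  length-filter-truncate P? k (x ∷ xs)
    with ih ← length-filter-truncate P? k xs | k ℕ.≤? count x (truncate k xs)
  length-filter-truncate P? k (x ∷ xs) | yes k≤ with P? x
  ... | yes px = inj₂ (ℕ.≤-trans k≤ (count≤length-filter P? px (truncate k xs)))
  ... | no _   = ih
  length-filter-truncate P? k (x ∷ xs) | no _ with P? x
  ... | no _   = ih
  ... | yes _  = Sum.map ℕ.s≤s ℕ.m≤n⇒m≤1+n ih

-- Cuts and splittings of multi-subsets of edges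

module _ (G : Multigraph) where
  open Multigraph G

  length-δ : ∀ F S → length (δ (G ⟨ F ⟩) S) ≡ length (filter (crosses? G S) F)
  length-δ F S = ≡.trans
    (≡.sym (length-filter-map (crosses? G S) (lookup F) (allFin (length F))))
    (cong (length ∘ filter (crosses? G S)) (map-lookup-allFin F))

  EdgeConnected-mono : ∀ {m n F F′} →
    (∀ S → m ℕ.≤ length (filter (crosses? G S) F) → n ℕ.≤ length (filter (crosses? G S) F′)) →
    EdgeConnected (G ⟨ F ⟩) m → EdgeConnected (G ⟨ F′ ⟩) n
  EdgeConnected-mono {F = F} {F′} h conn S ne S⊂⊤ =
    subst (_ ℕ.≤_) (≡.sym (length-δ F′ S)) (h S (subst (_ ℕ.≤_) (length-δ F S) (conn S ne S⊂⊤)))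

  EdgeConnected-truncate : ∀ k F →
    EdgeConnected (G ⟨ F ⟩) k → EdgeConnected (G ⟨ truncate Fin._≟_ k F ⟩) k
  EdgeConnected-truncate k F = EdgeConnected-mono {F = F} {truncate Fin._≟_ k F} cut
    where
    cut : ∀ S → k ℕ.≤ length (filter (crosses? G S) F) →
      k ℕ.≤ length (filter (crosses? G S) (truncate Fin._≟_ k F))
    cut S k≤ with length-filter-truncate Fin._≟_ (crosses? G S) k F
    ... | inj₁ F≤ = ℕ.≤-trans k≤ F≤
    ... | inj₂ k≤T = k≤T

  -- The edges of `G ⟨ F ⟩` are positions in `F`, so `P` is a list of positions. Looking them up
  -- turns `P` into a multi-subset of the edges of `G` with the same ends, hence with cuts of the
  -- same size.
  EdgeConnected-map-lookup : ∀ {m} F P →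
    EdgeConnected (G ⟨ F ⟩ ⟨ P ⟩) m → EdgeConnected (G ⟨ map (lookup F) P ⟩) m
  EdgeConnected-map-lookup F P conn S ne S⊂⊤ = subst (_ ℕ.≤_) same (conn S ne S⊂⊤)
    where
    open ≡.≡-Reasoning
    same : length (δ (G ⟨ F ⟩ ⟨ P ⟩) S) ≡ length (δ (G ⟨ map (lookup F) P ⟩) S)
    same = begin
      length (δ (G ⟨ F ⟩ ⟨ P ⟩) S)                        ≡⟨ length-δ⟨⟩ ⟩
      length (filter (crosses? G S ∘ lookup F) P)
        ≡⟨ length-filter-map (crosses? G S) (lookup F) P ⟨
      length (filter (crosses? G S) (map (lookup F) P))   ≡⟨ length-δ (map (lookup F) P) S ⟨
      length (δ (G ⟨ map (lookup F) P ⟩) S)               ∎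
      where
      length-δ⟨⟩ : length (δ (G ⟨ F ⟩ ⟨ P ⟩) S) ≡ length (filter (crosses? G S ∘ lookup F) P)
      length-δ⟨⟩ = ≡.trans
        (≡.sym (length-filter-map (crosses? G S ∘ lookup F) (lookup P) (allFin (length P))))
        (cong (length ∘ filter (crosses? G S ∘ lookup F)) (map-lookup-allFin P))

  -- The defining property of f is applied to the multigraph `G ⟨ F ⟩`, and both parts are pulled
  -- back from positions in `F` to edges of `G`.
  splitMultiSubset : ∀ {A B n} → f[ A , B ]≡ n → ∀ F → EdgeConnected (G ⟨ F ⟩) n →
    ∃[ P ] ∃[ Q ] (P ++ Q ↭ F × EdgeConnected (G ⟨ P ⟩) A × EdgeConnected (G ⟨ Q ⟩) B)
  splitMultiSubset (splits , _) F conn with splits (G ⟨ F ⟩) conn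
  ... | P , Q , PQ↭ , connP , connQ =
    map (lookup F) P , map (lookup F) Q ,
    ↭.↭-trans (↭.↭-reflexive (≡.sym (map-++ (lookup F) P Q)))
      (↭.↭-trans (↭.map⁺ (lookup F) PQ↭) (↭.↭-reflexive (map-lookup-allFin F))) ,
    EdgeConnected-map-lookup F P connP , EdgeConnected-map-lookup F Q connQ

-- Two isolated vertices form a 0-edge-connected multigraph, but no part of its empty edge set is
-- `A`-edge-connected with `A` positive. This keeps the iteration of k ↦ f(k,k) within the positive
-- integers.
f≢0 : ∀ {A B} → .{{NonZero A}} → ¬ (f[ A , B ]≡ 0)
f≢0 {A} (splits , _) with splits edgeless (λ _ _ _ → ℕ.z≤n)
  where
  edgeless : Multigraph
  edgeless = record { #V = 2 ; #E = 0 ; ends = λ () }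
... | () ∷ _ , _
... | [] , _ , _ , conn , _ = ℕ.<⇒≱ (ℕ.>-nonZero⁻¹ A)
  -- The violated cut separates the first vertex from the second.
  (conn (inside Vec.∷ outside Vec.∷ Vec.[]) (Fin.zero , Vec.here)
    (⊆⊤ , Fin.suc Fin.zero , ∈⊤ , λ { (Vec.there ()) }))

n<2^n : ∀ n → n ℕ.< 2 ℕ.^ n
n<2^n ℕ.zero    = ℕ.s≤s ℕ.z≤n
n<2^n (ℕ.suc n) = ℕ.+-mono-≤ (ℕ.≤-trans (ℕ.s≤s ℕ.z≤n) (n<2^n n))
  (ℕ.≤-trans (n<2^n n) (ℕ.m≤m+n _ _))

-- Arithmetic in an Archimedean ordered field

module OrderedFieldProperties {c ℓ₁ ℓ₂} (K : ArchimedeanOrderedField c ℓ₁ ℓ₂) where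
  open ArchimedeanOrderedField K
  open IsDecTotalOrder isDecTotalOrder public
    using (_≤?_; total; ≤-respˡ-≈; ≤-respʳ-≈; isPartialOrder)
    renaming (refl to ≤-refl; reflexive to ≤-reflexive; trans to ≤-trans; antisym to ≤-antisym)
  open RingProperties ring using (-‿distribˡ-*; -‿involutive)
  open SemiringMult semiring using (×1-homo-*)
  open SemiringSolver commutativeSemiring using (solve; _:+_; _:*_; _:=_)

  poset : Poset _ _ _
  poset = record { isPartialOrder = isPartialOrder }

  open PosetReasoning poset public

  ≰⇒≥ : ∀ {x y} → ¬ (x ≤ y) → y ≤ x
  ≰⇒≥ {x} {y} x≰y with total x y
  ... | inj₁ x≤y = ⊥-elim (x≰y x≤y)
  ... | inj₂ y≤x = y≤x

  +-monoʳ-≤ : ∀ x {y z} → y ≤ z → x + y ≤ x + z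
  +-monoʳ-≤ x {y} {z} y≤z = begin
    x + y  ≈⟨ +-comm x y ⟩
    y + x  ≤⟨ +-monoˡ-≤ x y≤z ⟩
    z + x  ≈⟨ +-comm z x ⟩
    x + z  ∎

  +-mono-≤ : ∀ {w x y z} → w ≤ x → y ≤ z → w + y ≤ x + z
  +-mono-≤ w≤x y≤z = ≤-trans (+-monoˡ-≤ _ w≤x) (+-monoʳ-≤ _ y≤z)

  x+y-x≈y : ∀ x y → - x + (x + y) ≈ y
  x+y-x≈y x y = trans (sym (+-assoc (- x) x y)) (trans (+-congʳ (-‿inverseˡ x)) (+-identityˡ y))

  +-cancelˡ-≤ : ∀ x {y z} → x + y ≤ x + z → y ≤ z
  +-cancelˡ-≤ x {y} {z} le = begin
    y                ≈⟨ x+y-x≈y x y ⟨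
    - x + (x + y)    ≤⟨ +-monoʳ-≤ (- x) le ⟩
    - x + (x + z)    ≈⟨ x+y-x≈y x z ⟩
    z                ∎

  x+[y-x]≈y : ∀ x y → x + (y - x) ≈ y
  x+[y-x]≈y x y = trans (+-comm x (y - x))
    (trans (+-assoc y (- x) x) (trans (+-congˡ (-‿inverseˡ x)) (+-identityʳ y)))

  x≤y⇒0≤y-x : ∀ {x y} → x ≤ y → 0# ≤ y - x
  x≤y⇒0≤y-x {x} {y} x≤y = begin
    0#     ≈⟨ -‿inverseʳ x ⟨
    x - x  ≤⟨ +-monoˡ-≤ (- x) x≤y ⟩
    y - x  ∎

  *-monoʳ-≤ : ∀ {x y z} → 0# ≤ x → y ≤ z → x * y ≤ x * z
  *-monoʳ-≤ {x} {y} {z} 0≤x y≤z = begin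
    x * y                ≈⟨ +-identityʳ _ ⟨
    x * y + 0#           ≤⟨ +-monoʳ-≤ _ (*-nonneg 0≤x (x≤y⇒0≤y-x y≤z)) ⟩
    x * y + x * (z - y)  ≈⟨ distribˡ x y (z - y) ⟨
    x * (y + (z - y))    ≈⟨ *-congˡ (x+[y-x]≈y y z) ⟩
    x * z                ∎

  *-monoˡ-≤ : ∀ {x y z} → 0# ≤ x → y ≤ z → y * x ≤ z * x
  *-monoˡ-≤ {x} {y} {z} 0≤x y≤z = begin
    y * x  ≈⟨ *-comm y x ⟩
    x * y  ≤⟨ *-monoʳ-≤ 0≤x y≤z ⟩
    x * z  ≈⟨ *-comm x z ⟩
    z * x  ∎

  0≤1 : 0# ≤ 1#
  0≤1 with total 0# 1#
  ... | inj₁ 0≤1 = 0≤1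
  ... | inj₂ 1≤0 = begin
    0#             ≤⟨ *-nonneg 0≤-1 0≤-1 ⟩
    - 1# * - 1#    ≈⟨ -‿distribˡ-* 1# (- 1#) ⟨
    - (1# * - 1#)  ≈⟨ -‿cong (*-identityˡ (- 1#)) ⟩
    - - 1#         ≈⟨ -‿involutive 1# ⟩
    1#             ∎
    where
    0≤-1 : 0# ≤ - 1#
    0≤-1 = ≤-respʳ-≈ (+-identityˡ (- 1#)) (x≤y⇒0≤y-x 1≤0)

  1≰0 : ¬ (1# ≤ 0#)
  1≰0 1≤0 = 0≉1 (≤-antisym 0≤1 1≤0)

  0≤n×1 : ∀ n → 0# ≤ n ×1
  0≤n×1 ℕ.zero    = ≤-refl
  0≤n×1 (ℕ.suc n) = ≤-respˡ-≈ (+-identityˡ 0#) (+-mono-≤ 0≤1 (0≤n×1 n))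

  ×1-mono-≤ : ∀ {m n} → m ℕ.≤ n → m ×1 ≤ n ×1
  ×1-mono-≤ {n = n} ℕ.z≤n = 0≤n×1 n
  ×1-mono-≤ (ℕ.s≤s m≤n) = +-monoʳ-≤ 1# (×1-mono-≤ m≤n)

  -- Transfers inequalities from the field back to natural numbers: cut sizes are estimated in the
  -- field, but edge-connectivity is a statement about `ℕ`.
  ×1-cancel-≤ : ∀ m n → m ×1 ≤ n ×1 → m ℕ.≤ n
  ×1-cancel-≤ ℕ.zero    n         _  = ℕ.z≤n
  ×1-cancel-≤ (ℕ.suc m) ℕ.zero    le = ⊥-elim (1≰0 (begin
    1#           ≈⟨ +-identityʳ 1# ⟨
    1# + 0#      ≤⟨ +-monoʳ-≤ 1# (0≤n×1 m) ⟩
    1# + m ×1    ≤⟨ le ⟩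
    0#           ∎))
  ×1-cancel-≤ (ℕ.suc m) (ℕ.suc n) le = ℕ.s≤s (×1-cancel-≤ m n (+-cancelˡ-≤ 1# le))

  k×1≉0 : ∀ k → .{{NonZero k}} → ¬ (k ×1 ≈ 0#)
  k×1≉0 k k≈0 = ℕ.<⇒≱ (ℕ.>-nonZero⁻¹ k) (×1-cancel-≤ k 0 (≤-reflexive k≈0))

  *-inverse-nonneg : ∀ {x} → 0# ≤ x → ¬ (x ≈ 0#) → 0# ≤ x ⁻¹
  *-inverse-nonneg {x} 0≤x x≉0 with total 0# (x ⁻¹)
  ... | inj₁ 0≤x⁻¹ = 0≤x⁻¹
  ... | inj₂ x⁻¹≤0 = ⊥-elim (1≰0 (begin
    1#         ≈⟨ *-inverseʳ x≉0 ⟨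
    x * x ⁻¹   ≤⟨ *-monoʳ-≤ 0≤x x⁻¹≤0 ⟩
    x * 0#     ≈⟨ zeroʳ x ⟩
    0#         ∎))

  -- The Archimedean property supplies some upper bound `N`, which is lowered until `N - 1` fails to
  -- bound `y` or zero is reached; at zero, `0# ≤ y` gives the second inequality.
  ceiling : ∀ y → 0# ≤ y → ∃[ n ] (y ≤ n ×1 × n ×1 ≤ y + 1#)
  ceiling y 0≤y = let N , y≤N = archimedean y in search N y≤N
    where
    search : ∀ N → y ≤ N ×1 → ∃[ n ] (y ≤ n ×1 × n ×1 ≤ y + 1#)
    search ℕ.zero y≤0 = 0 , y≤0 , ≤-respˡ-≈ (+-identityˡ 0#) (+-mono-≤ 0≤y 0≤1)
    search (ℕ.suc N) y≤1+N with y ≤? N ×1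
    ... | yes y≤N = search N y≤N
    ... | no y≰N  = ℕ.suc N , y≤1+N , (begin
      1# + N ×1  ≤⟨ +-monoʳ-≤ 1# (≰⇒≥ y≰N) ⟩
      1# + y     ≈⟨ +-comm 1# y ⟩
      y + 1#     ∎)

  -- If `x` exceeds `y` by `d`, the scaled inequality forces `m ×1 * d ≤ D`, which fails for large
  -- `m`. The threshold depends only on `D`, `x` and `y`, so one inequality at a large `m` suffices
  -- and no limit is taken.
  ≤-from-scaled : ∀ D x y →
    ∃[ n ] (∀ m → n ℕ.≤ m → m ×1 * x ≤ m ×1 * y + D → x ≤ y)
  ≤-from-scaled D x y with x ≤? y
  ... | yes x≤y = 0 , λ _ _ _ → x≤y
  ... | no x≰y  = let n , D/d≤n = archimedean (D * d ⁻¹) in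
    -- Since `n` bounds `D / d`, the successor is needed for a strict excess: `m ×1 * d` is at least
    -- `n ×1 * d + d`, whereas `D` is at most `n ×1 * d`.
    ℕ.suc n , λ m n<m le → ⊥-elim (d≰0 (+-cancelˡ-≤ (n ×1 * d) (begin
      n ×1 * d + d         ≈⟨ solve 2 (λ a b → a :+ b := b :+ a) refl (n ×1 * d) d ⟩
      d + n ×1 * d         ≈⟨ +-congʳ (*-identityˡ d) ⟨
      1# * d + n ×1 * d    ≈⟨ distribʳ d 1# (n ×1) ⟨
      (ℕ.suc n) ×1 * d     ≤⟨ *-monoˡ-≤ 0≤d (×1-mono-≤ n<m) ⟩
      m ×1 * d             ≤⟨ +-cancelˡ-≤ (m ×1 * y) (shift m le) ⟩
      D                    ≈⟨ *-identityʳ D ⟨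
      D * 1#               ≈⟨ *-congˡ (*-inverseʳ d≉0) ⟨
      D * (d * d ⁻¹)       ≈⟨ solve 3 (λ a b c → a :* (b :* c) := (a :* c) :* b) refl D d (d ⁻¹) ⟩
      D * d ⁻¹ * d         ≤⟨ *-monoˡ-≤ 0≤d D/d≤n ⟩
      n ×1 * d             ≈⟨ +-identityʳ _ ⟨
      n ×1 * d + 0#        ∎)))
    where
    d : Carrier
    d = x - y
    d≰0 : ¬ (d ≤ 0#)
    d≰0 d≤0 = x≰y (begin
      x            ≈⟨ x+[y-x]≈y y x ⟨
      y + (x - y)  ≤⟨ +-monoʳ-≤ y d≤0 ⟩
      y + 0#       ≈⟨ +-identityʳ y ⟩
      y            ∎)
    d≉0 : ¬ (d ≈ 0#)
    d≉0 d≈0 = d≰0 (≤-reflexive d≈0)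
    0≤d : 0# ≤ d
    0≤d = ≰⇒≥ d≰0
    shift : ∀ m → m ×1 * x ≤ m ×1 * y + D → m ×1 * y + m ×1 * d ≤ m ×1 * y + D
    shift m le = begin
      m ×1 * y + m ×1 * d  ≈⟨ distribˡ (m ×1) y d ⟨
      m ×1 * (y + d)       ≈⟨ *-congˡ (x+[y-x]≈y y x) ⟩
      m ×1 * x             ≤⟨ le ⟩
      m ×1 * y + D         ∎

  -- The maximum of the finitely many thresholds serves all entries at once. Uniformity matters
  -- because the entry to which this is applied is constructed only after `m` has been fixed.
  ≤-from-scaled-all : ∀ {a} {A : Set a} D y (g : A → Carrier) xs →
    ∃[ n ] (∀ m → n ℕ.≤ m → ∀ {x} → x ∈ xs → m ×1 * g x ≤ m ×1 * y + D → g x ≤ y)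
  ≤-from-scaled-all D y g [] = 0 , λ _ _ ()
  ≤-from-scaled-all D y g (x ∷ xs)
    with ≤-from-scaled D (g x) y | ≤-from-scaled-all D y g xs
  ... | n₁ , p₁ | n₂ , p₂ = n₁ ℕ.⊔ n₂ , λ where
    m n≤m (here ≡.refl) → p₁ m (ℕ.m⊔n≤o⇒m≤o n₁ n₂ n≤m)
    m n≤m (there i)     → p₂ m (ℕ.m⊔n≤o⇒n≤o n₁ n₂ n≤m) i

  -- Finite sums over lists

  module _ {a} {A : Set a} where

    ∑-++ : ∀ xs ys (g : A → Carrier) → ∑ (xs ++ ys) g ≈ ∑ xs g + ∑ ys g
    ∑-++ []       ys g = sym (+-identityˡ _)
    ∑-++ (x ∷ xs) ys g = trans (+-congˡ (∑-++ xs ys g)) (sym (+-assoc _ _ _))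

    ∑-↭ : ∀ {xs ys} (g : A → Carrier) → xs ↭ ys → ∑ xs g ≈ ∑ ys g
    ∑-↭ g ↭.refl           = refl
    ∑-↭ g (↭.prep x p)     = +-congˡ (∑-↭ g p)
    ∑-↭ g (↭.swap x y p)   = trans (+-congˡ (+-congˡ (∑-↭ g p)))
      (solve 3 (λ a b c → a :+ (b :+ c) := b :+ (a :+ c)) refl (g x) (g y) _)
    ∑-↭ g (↭.trans p q)    = trans (∑-↭ g p) (∑-↭ g q)

    ∑-mono-≤ : ∀ xs {g h : A → Carrier} → (∀ x → g x ≤ h x) → ∑ xs g ≤ ∑ xs h
    ∑-mono-≤ []       g≤h = ≤-refl
    ∑-mono-≤ (x ∷ xs) g≤h = +-mono-≤ (g≤h x) (∑-mono-≤ xs g≤h)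

    ∑-nonneg : ∀ xs {g : A → Carrier} → (∀ x → 0# ≤ g x) → 0# ≤ ∑ xs g
    ∑-nonneg []       0≤g = ≤-refl
    ∑-nonneg (x ∷ xs) 0≤g = ≤-respˡ-≈ (+-identityˡ 0#) (+-mono-≤ (0≤g x) (∑-nonneg xs 0≤g))

    ∑-⊆ : ∀ {xs ys} {g : A → Carrier} → (∀ x → 0# ≤ g x) → xs ⊆ ys → ∑ xs g ≤ ∑ ys g
    ∑-⊆ 0≤g Sublist.[]              = ≤-refl
    ∑-⊆ 0≤g (y Sublist.∷ʳ p)        = ≤-respˡ-≈ (+-identityˡ _) (+-mono-≤ (0≤g y) (∑-⊆ 0≤g p))
    ∑-⊆ 0≤g (≡.refl Sublist.∷ p)    = +-monoʳ-≤ _ (∑-⊆ 0≤g p)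

    *-distribˡ-∑ : ∀ z xs (g : A → Carrier) → z * ∑ xs g ≈ ∑ xs (λ x → z * g x)
    *-distribˡ-∑ z []       g = zeroʳ z
    *-distribˡ-∑ z (x ∷ xs) g = trans (distribˡ z _ _) (+-congˡ (*-distribˡ-∑ z xs g))

    ∑-distrib-+ : ∀ xs (g h : A → Carrier) → ∑ xs (λ x → g x + h x) ≈ ∑ xs g + ∑ xs h
    ∑-distrib-+ []       g h = sym (+-identityˡ 0#)
    ∑-distrib-+ (x ∷ xs) g h = trans (+-congˡ (∑-distrib-+ xs g h))
      (solve 4 (λ a b c d → (a :+ b) :+ (c :+ d) := (a :+ c) :+ (b :+ d)) refl (g x) (h x) _ _)

    ∑-replicate : ∀ n x (g : A → Carrier) → ∑ (replicate n x) g ≈ n ×1 * g x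
    ∑-replicate ℕ.zero    x g = sym (zeroˡ (g x))
    ∑-replicate (ℕ.suc n) x g = sym (trans (distribʳ (g x) 1# (n ×1))
      (+-cong (*-identityˡ (g x)) (sym (∑-replicate n x g))))

    ∑-withMultiplicity : ∀ m xs (g : A → Carrier) →
      ∑ (withMultiplicity m xs) g ≈ ∑ xs (λ x → m x ×1 * g x)
    ∑-withMultiplicity m []       g = refl
    ∑-withMultiplicity m (x ∷ xs) g = trans (∑-++ (replicate (m x) x) _ g)
      (+-cong (∑-replicate (m x) x g) (∑-withMultiplicity m xs g))

    length×1 : ∀ (xs : List A) → length xs ×1 ≈ ∑ xs (const 1#)
    length×1 []       = refl
    length×1 (x ∷ xs) = +-congˡ (length×1 xs)

  2×1*[x]≈x+x : ∀ x → 2 ×1 * x ≈ x + x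
  2×1*[x]≈x+x x = trans (*-congʳ (+-congˡ (+-identityʳ 1#)))
    (trans (distribʳ x 1# 1#) (+-cong (*-identityˡ x) (*-identityˡ x)))

  -- Iterated splitting, keeping the cheaper part

  module _ (G : Multigraph) (cost : Fin (Multigraph.#E G) → Carrier) where

    cheaperPart : ∀ {k n} → f[ k , k ]≡ n → ∀ F → EdgeConnected (G ⟨ F ⟩) n →
      ∃[ P ] (EdgeConnected (G ⟨ P ⟩) k × 2 ×1 * ∑ P cost ≤ ∑ F cost)
    cheaperPart f≡n F conn with splitMultiSubset G f≡n F conn
    ... | P , Q , PQ↭F , connP , connQ with total (∑ P cost) (∑ Q cost)
    ...   | inj₁ P≤Q = P , connP , (begin
      2 ×1 * ∑ P cost      ≈⟨ 2×1*[x]≈x+x _ ⟩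
      ∑ P cost + ∑ P cost  ≤⟨ +-monoʳ-≤ _ P≤Q ⟩
      ∑ P cost + ∑ Q cost  ≈⟨ ∑-++ P Q cost ⟨
      ∑ (P ++ Q) cost      ≈⟨ ∑-↭ cost PQ↭F ⟩
      ∑ F cost             ∎)
    ...   | inj₂ Q≤P = Q , connQ , (begin
      2 ×1 * ∑ Q cost      ≈⟨ 2×1*[x]≈x+x _ ⟩
      ∑ Q cost + ∑ Q cost  ≤⟨ +-monoˡ-≤ _ Q≤P ⟩
      ∑ P cost + ∑ Q cost  ≈⟨ ∑-++ P Q cost ⟨
      ∑ (P ++ Q) cost      ≈⟨ ∑-↭ cost PQ↭F ⟩
      ∑ F cost             ∎)

    -- Induction on `j` with `k` general: the induction hypothesis is used at `n`, the value of
    -- f(k,k), to come down from `g` to `n`, and one further split comes down from `n` to `k`. The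
    -- bound on `g` is phrased with `C` added because `k ×1 + C` then at most doubles at each level.
    cheapPart : ∀ C →
      (∀ k → .{{NonZero k}} → ∃[ n ] (f[ k , k ]≡ n × n ×1 ≤ (2 ℕ.* k) ×1 + C)) →
      ∀ j k → .{{NonZero k}} →
      ∃[ g ] (g ×1 + C ≤ (2 ℕ.^ j) ×1 * (k ×1 + C)
              × (∀ F → EdgeConnected (G ⟨ F ⟩) g →
                  ∃[ P ] (EdgeConnected (G ⟨ P ⟩) k × (2 ℕ.^ j) ×1 * ∑ P cost ≤ ∑ F cost)))
    cheapPart C f≤ ℕ.zero k = k , ≤-reflexive (sym (1×1*x≈x _)) ,
      λ F conn → F , conn , ≤-reflexive (1×1*x≈x _)
      where
      1×1*x≈x : ∀ x → 1 ×1 * x ≈ x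
      1×1*x≈x x = trans (*-congʳ (+-identityʳ 1#)) (*-identityˡ x)
    cheapPart C f≤ (ℕ.suc j) k with f≤ k
    -- Positivity of `n` must be established before the induction hypothesis can be used at `n`.
    ... | ℕ.zero , f≡0 , _ = ⊥-elim (f≢0 f≡0)
    ... | n@(ℕ.suc _) , f≡n , n≤2k+C with cheapPart C f≤ j n
    ...   | g , g+C≤ , reduce = g , bound , part
      where
      2^j = (2 ℕ.^ j) ×1

      bound : g ×1 + C ≤ (2 ℕ.^ ℕ.suc j) ×1 * (k ×1 + C)
      bound = begin
        g ×1 + C                                  ≤⟨ g+C≤ ⟩
        2^j * (n ×1 + C)                          ≤⟨ *-monoʳ-≤ (0≤n×1 (2 ℕ.^ j)) (+-monoˡ-≤ C n≤2k+C) ⟩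
        2^j * (((2 ℕ.* k) ×1 + C) + C)
          ≈⟨ *-congˡ (+-congʳ (+-congʳ (trans (×1-homo-* 2 k) (2×1*[x]≈x+x _)))) ⟩
        2^j * (((k ×1 + k ×1) + C) + C)
          ≈⟨ *-congˡ (solve 2 (λ a b → ((a :+ a) :+ b) :+ b := (a :+ b) :+ (a :+ b)) refl (k ×1) C) ⟩
        2^j * ((k ×1 + C) + (k ×1 + C))           ≈⟨ *-congˡ (2×1*[x]≈x+x _) ⟨
        2^j * (2 ×1 * (k ×1 + C))
          ≈⟨ solve 3 (λ a b c → a :* (b :* c) := (b :* a) :* c) refl 2^j (2 ×1) (k ×1 + C) ⟩
        (2 ×1 * 2^j) * (k ×1 + C)                 ≈⟨ *-congʳ (×1-homo-* 2 (2 ℕ.^ j)) ⟨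
        (2 ℕ.^ ℕ.suc j) ×1 * (k ×1 + C)           ∎

      part : ∀ F → EdgeConnected (G ⟨ F ⟩) g →
        ∃[ P ] (EdgeConnected (G ⟨ P ⟩) k × (2 ℕ.^ ℕ.suc j) ×1 * ∑ P cost ≤ ∑ F cost)
      part F conn with reduce F conn
      ... | Q , connQ , Q≤F with cheaperPart f≡n Q connQ
      ...   | P , connP , P≤Q = P , connP , (begin
        (2 ℕ.^ ℕ.suc j) ×1 * ∑ P cost   ≈⟨ *-congʳ (×1-homo-* 2 (2 ℕ.^ j)) ⟩
        (2 ×1 * 2^j) * ∑ P cost
          ≈⟨ solve 3 (λ a b c → (b :* a) :* c := a :* (b :* c)) refl 2^j (2 ×1) _ ⟩
        2^j * (2 ×1 * ∑ P cost)         ≤⟨ *-monoʳ-≤ (0≤n×1 (2 ℕ.^ j)) P≤Q ⟩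
        2^j * ∑ Q cost                  ≤⟨ Q≤F ⟩
        ∑ F cost                        ∎)

  -- Rounding the LP solution and removing the error term

  module _ (k : ℕ) .{{_ : NonZero k}} (I : Instance K) where
    open Instance I

    -- Scaling by g / k raises every cut from at least `k` to at least `g`, and rounding up
    -- preserves this. Rounding adds at most one copy of each edge, hence the additive term
    -- independent of `g`.
    roundUp : ∀ {x} → LPFeasible K k I x → ∀ g →
      ∃[ F ] (EdgeConnected (graph ⟨ F ⟩) g
              × totalCost F ≤ g ×1 * ((k ×1) ⁻¹ * lpCost x) + ∑ (allFin #E) cost)
    roundUp {x} feasible g = F , conn , cost≤
      where
      open LPFeasible feasible
      N : Carrier
      N = g ×1 * (k ×1) ⁻¹
      0≤N : 0# ≤ N
      0≤N = *-nonneg (0≤n×1 g) (*-inverse-nonneg (0≤n×1 k) (k×1≉0 k))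
      rounded : ∀ e → ∃[ n ] (N * x e ≤ n ×1 × n ×1 ≤ N * x e + 1#)
      rounded e = ceiling (N * x e) (*-nonneg 0≤N (x≥0 e))
      m : Fin #E → ℕ
      m e = proj₁ (rounded e)
      F : List (Fin #E)
      F = withMultiplicity m (allFin #E)

      conn : EdgeConnected (graph ⟨ F ⟩) g
      conn S ne S⊂⊤ = ×1-cancel-≤ g _ (begin
        g ×1                                       ≈⟨ *-identityʳ _ ⟨
        g ×1 * 1#                                  ≈⟨ *-congˡ (*-inverseʳ (k×1≉0 k)) ⟨
        g ×1 * (k ×1 * (k ×1) ⁻¹)
          ≈⟨ solve 3 (λ a b c → a :* (b :* c) := (a :* c) :* b) refl (g ×1) (k ×1) ((k ×1) ⁻¹) ⟩
        N * k ×1                                   ≤⟨ *-monoʳ-≤ 0≤N (cut≥k S ne S⊂⊤) ⟩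
        N * ∑ (δ graph S) x                        ≈⟨ *-distribˡ-∑ N (δ graph S) x ⟩
        ∑ (δ graph S) (λ e → N * x e)
          ≤⟨ ∑-mono-≤ (δ graph S) (λ e → ≤-respʳ-≈ (sym (*-identityʳ _)) (proj₁ (proj₂ (rounded e)))) ⟩
        ∑ (δ graph S) (λ e → m e ×1 * 1#)          ≈⟨ ∑-withMultiplicity m (δ graph S) (const 1#) ⟨
        ∑ (withMultiplicity m (δ graph S)) (const 1#) ≈⟨ length×1 (withMultiplicity m (δ graph S)) ⟨
        length (withMultiplicity m (δ graph S)) ×1
          ≡⟨ cong (λ xs → length xs ×1) (filter-withMultiplicity (crosses? graph S) m (allFin #E)) ⟨
        length (filter (crosses? graph S) F) ×1    ≡⟨ cong _×1 (length-δ graph F S) ⟨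
        length (δ (graph ⟨ F ⟩) S) ×1              ∎)

      cost≤ : totalCost F ≤ g ×1 * ((k ×1) ⁻¹ * lpCost x) + ∑ (allFin #E) cost
      cost≤ = begin
        totalCost F                                            ≈⟨ ∑-withMultiplicity m (allFin #E) cost ⟩
        ∑ (allFin #E) (λ e → m e ×1 * cost e)                  ≤⟨ ∑-mono-≤ (allFin #E) term≤ ⟩
        ∑ (allFin #E) (λ e → N * (cost e * x e) + cost e)
          ≈⟨ ∑-distrib-+ (allFin #E) (λ e → N * (cost e * x e)) cost ⟩
        ∑ (allFin #E) (λ e → N * (cost e * x e)) + ∑ (allFin #E) cost
          ≈⟨ +-congʳ (*-distribˡ-∑ N (allFin #E) (λ e → cost e * x e)) ⟨
        N * lpCost x + ∑ (allFin #E) cost                      ≈⟨ +-congʳ (*-assoc _ _ _) ⟩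
        g ×1 * ((k ×1) ⁻¹ * lpCost x) + ∑ (allFin #E) cost     ∎
        where
        term≤ : ∀ e → m e ×1 * cost e ≤ N * (cost e * x e) + cost e
        term≤ e = begin
          m e ×1 * cost e                ≤⟨ *-monoˡ-≤ (cost≥0 e) (proj₂ (proj₂ (rounded e))) ⟩
          (N * x e + 1#) * cost e        ≈⟨ distribʳ (cost e) (N * x e) 1# ⟩
          N * x e * cost e + 1# * cost e
            ≈⟨ +-cong (solve 3 (λ a b c → (a :* b) :* c := a :* (c :* b)) refl N (x e) (cost e)) (*-identityˡ (cost e)) ⟩
          N * (cost e * x e) + cost e    ∎

    -- Contains a feasible solution no costlier than any given one.
    candidates : List (List (Fin #E))
    candidates = listsUpTo (length (allFin #E) ℕ.* k) (allFin #E)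

    -- Each edge survives at most `k` times, so the truncated list has length at most `k` times the
    -- number of edges.
    truncate∈candidates : ∀ F → truncate Fin._≟_ k F ∈ candidates
    truncate∈candidates F = ∈-listsUpTo _ T edges
      (length≤length*count Fin._≟_ k (allFin #E) T edges (λ e → count-truncate Fin._≟_ k e F))
      where
      T : List (Fin #E)
      T = truncate Fin._≟_ k F
      edges : All (_∈ allFin #E) T
      edges = All.universal ∈-allFin T

    cheapSolution : ∀ C →
      (∀ k → .{{NonZero k}} → ∃[ n ] (f[ k , k ]≡ n × n ×1 ≤ (2 ℕ.* k) ×1 + C)) →
      ∀ opt → IsLPOptimum K k I opt →
      ∃[ F ] (Feasible K k I F × totalCost F ≤ (1# + C * (k ×1) ⁻¹) * opt)
    cheapSolution C f≤ opt ((x , feasible , x≈opt) , _)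
      -- The error `D` is the rounding cost minus `C * q`, where `q` is the LP cost divided by `k`:
      -- the `C * q` taken away here completes `g ×1` to `g ×1 + C` below. Neither `D` nor the
      -- candidate list involves `j`, so the threshold can be fixed first.
      with ≤-from-scaled-all (∑ (allFin #E) cost - C * ((k ×1) ⁻¹ * lpCost x))
             ((1# + C * (k ×1) ⁻¹) * opt) totalCost candidates
    -- The threshold itself is taken as the number of splittings, which suffices because the scale
    -- `2 ℕ.^ j` exceeds `j`.
    ... | j , limit with cheapPart graph cost C f≤ j k
    ...   | g , g+C≤ , reduce with roundUp feasible g
    ...     | F , connF , F≤ with reduce F connF
    -- `P` may be arbitrarily long, so it is truncated to `T`, which stays feasible, costs no more,
    -- and lies among the candidates covered by `limit`.
    ...       | P , connP , P≤F = T , EdgeConnected-truncate graph k P connP ,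
      limit (2 ℕ.^ j) (ℕ.<⇒≤ (n<2^n j)) (truncate∈candidates P) (begin
        2^j * totalCost T        ≤⟨ *-monoʳ-≤ (0≤n×1 (2 ℕ.^ j)) (∑-⊆ cost≥0 (truncate-⊆ Fin._≟_ k P)) ⟩
        2^j * totalCost P        ≤⟨ P≤F ⟩
        totalCost F              ≤⟨ F≤ ⟩
        g ×1 * q + D₀            ≈⟨ +-congˡ (x+[y-x]≈y (C * q) D₀) ⟨
        g ×1 * q + (C * q + D)
          ≈⟨ solve 4 (λ a b c d → a :* b :+ (c :* b :+ d) := (a :+ c) :* b :+ d) refl (g ×1) q C D ⟩
        (g ×1 + C) * q + D       ≤⟨ +-monoˡ-≤ D (*-monoˡ-≤ 0≤q g+C≤) ⟩
        2^j * (k ×1 + C) * q + D ≈⟨ +-congʳ (trans (*-assoc _ _ _) (*-congˡ [k+C]q≈)) ⟩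
        2^j * ((1# + C * (k ×1) ⁻¹) * opt) + D  ∎)
      where
      T : List (Fin #E)
      T = truncate Fin._≟_ k P
      2^j q D₀ D : Carrier
      2^j = (2 ℕ.^ j) ×1
      q = (k ×1) ⁻¹ * lpCost x
      D₀ = ∑ (allFin #E) cost
      D = D₀ - C * q
      0≤q : 0# ≤ q
      0≤q = *-nonneg (*-inverse-nonneg (0≤n×1 k) (k×1≉0 k))
        (∑-nonneg (allFin #E) (λ e → *-nonneg (cost≥0 e) (LPFeasible.x≥0 feasible e)))
      [k+C]q≈ : (k ×1 + C) * q ≈ (1# + C * (k ×1) ⁻¹) * opt
      [k+C]q≈ = trans
        (solve 4 (λ a b c d → (a :+ c) :* (b :* d) := (a :* b :+ c :* b) :* d) refl
          (k ×1) ((k ×1) ⁻¹) C (lpCost x))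
        (*-cong (+-congʳ (*-inverseʳ (k×1≉0 k))) x≈opt)

theorem7 : ∀ {c ℓ₁ ℓ₂} (K : ArchimedeanOrderedField c ℓ₁ ℓ₂) →
    let open ArchimedeanOrderedField K in
    (C : Carrier) →
    (∀ k → .{{NonZero k}} → ∃[ n ] (f[ k , k ]≡ n × n ×1 ≤ (2 ℕ.* k) ×1 + C)) →
    ∀ k → .{{NonZero k}} →
    (∀ (I : Instance K) opt → IsLPOptimum K k I opt →
    ∃[ F ] (Feasible K k I F × Instance.totalCost I F ≤ (1# + C * (k ×1) ⁻¹) * opt))
    × IntegralityGapAtMost K k (1# + C * (k ×1) ⁻¹)
theorem7 K C f≤ k = (λ I → cheapSolution k I C f≤) , λ I opt lp (_ , opt≤) lpOptimum →
  let F , feasible , cost≤ = cheapSolution k I C f≤ lp lpOptimum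
  in ≤-trans (opt≤ _ (F , feasible , refl)) cost≤
  where
  open ArchimedeanOrderedField K using (refl)
  open OrderedFieldProperties K using (cheapSolution; ≤-trans)
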